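{- Let $\mathcal{A}$ be a monoid of games that is outcome-stable, hereditary, integer-invertible, and has Property X. Then $\mathcal{P}(\mathcal{A})$, the set of strictly $\mathscr{P}$-free elements of $\mathcal{A}$, is a monoid (in particular it is closed under disjunctive sum).
   Context: Games are short misère-play game forms, possibly augmented in Siegel's sense: any subposition may additionally carry a Left and/or Right tombstone among its options; if a Left (Right) tombstone is present, Left (Right) is deemed to win moving first from there. A game is Left end-like if it has no Left options or has a Left tombstone (Right end-like symmetrically). Outcomes $o(G)\in\{\mathscr{L},\mathscr{N},\mathscr{P},\mathscr{R}\}$; $o_L(G)$, $o_R(G)$ denote the outcome with Left, resp. Right, moving first. $+$ is disjunctive sum, $\overline{G}$ the conjugate, $0=\{\cdot\mid\cdot\}$; for $n\ge1$ the integer $n$ is $\{n-1\mid\cdot\}$ and $\overline{n}$ its conjugate; for $k\in\mathbb{Z}$, $G+k$ means $G+\overline{ -k}$ if $k<0$. A subposition of $G$ is any game reachable by a possibly empty, not necessarily alternating, sequence of moves. A game is strictly $\mathscr{P}$-free if no subposition has outcome $\mathscr{P}$; $\mathcal{P}(\mathcal{A})$ is the set of strictly $\mathscr{P}$-free elements of $\mathcal{A}$. $G\geq_{\mathcal{A}}H$ iff $o(G+X)\geq o(H+X)$ for all $X\in\mathcal{A}$; $\equiv_{\mathcal{A}}$ is the associated equivalence. A monoid of games is a nonempty set $\mathcal{A}$ closed under $+$ that contains an identity modulo $\equiv_{\mathcal{A}}$. $\mathcal{A}$ is hereditary if it contains every option of each of its elements. $\mathcal{A}$ is integer-invertible if $n,\overline{n}\in\mathcal{A}$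 and $n+\overline{n}\equiv_{\mathcal{A}}0$ for all integers $n\ge0$. $\mathcal{A}$ is outcome-stable if for all $G,H\in\mathcal{P}(\mathcal{A})$: (1) $o(G)=o(H)=\mathscr{L}$ implies $o(G+H)=\mathscr{L}$; (2) $o(G)=o(H)=\mathscr{R}$ implies $o(G+H)=\mathscr{R}$; (3) $o(G)=\mathscr{L}$, $o(H)=\mathscr{N}$ implies $o_L(G+H)=\mathscr{L}$; (4) $o(G)=\mathscr{R}$, $o(H)=\mathscr{N}$ implies $o_R(G+H)=\mathscr{R}$. Tipping points: $\mathrm{ltp}(G)$ is the least integer $m\ge0$ with $o(G+\overline{m})=\mathscr{L}$, $\mathrm{rtp}(G)$ the least $m\ge0$ with $o(G+m)=\mathscr{R}$. $\mathcal{A}$ has Property X if for all $G,H\in\mathcal{P}(\mathcal{A})$ with $o(G)=o(H)=\mathscr{N}$: (1) if $\mathrm{rtp}(G)=\mathrm{ltp}(H)=1$, $G$ is Left end-like and $H$ is not, then $o(G+H)=\mathscr{N}$; (2) if $\mathrm{ltp}(G)=\mathrm{rtp}(H)=1$, $H$ is Right end-like and $G$ is not, then $o(G+H)=\mathscr{N}$. -}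

module Defs where

open import Data.Bool using (Bool; true; false; _∨_; _∧_; not; if_then_else_)
open import Data.List using (List; []; _∷_; _++_; null)
open import Data.List.Membership.Propositional using (_∈_)
open import Data.Nat using (ℕ; zero; suc; _<_)
open import Data.Product using (Σ; _×_; _,_)
open import Data.Sum using (_⊎_)
open import Data.Unit using (⊤)
open import Data.Empty using (⊥)
open import Relation.Binary.PropositionalEquality using (_≡_)
open import Relation.Nullary using (¬_)

-- Short (finite) augmented misère game forms.
-- mk ltomb rtomb Ls Rs : ltomb/rtomb say whether a Left/Right tombstone
-- is present; Ls/Rs are the (ordinary) Left/Right options.

data Game : Set where
  mk : (ltomb rtomb : Bool) → (Ls Rs : List Game) → Game

leftTomb rightTomb : Game → Bool
leftTomb  (mk a _ _ _) = a
rightTomb (mk _ b _ _) = b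

leftOpts rightOpts : Game → List Game
leftOpts  (mk _ _ ls _) = ls
rightOpts (mk _ _ _ rs) = rs

leftEndLikeᵇ rightEndLikeᵇ : Game → Bool
leftEndLikeᵇ  (mk a _ ls _) = a ∨ null ls
rightEndLikeᵇ (mk _ b _ rs) = b ∨ null rs

LeftEndLike RightEndLike : Game → Set
LeftEndLike  G = leftEndLikeᵇ G ≡ true
RightEndLike G = rightEndLikeᵇ G ≡ true

-- Misère winning: lf G = Left wins moving first, rf G = Right wins moving first.
-- A player wins moving first iff the position is end-like for her
-- (tombstone present or no options) or she has a move to a position from
-- which the opponent, moving first, loses.

mutual
  lf : Game → Bool
  lf (mk a _ ls _) = a ∨ null ls ∨ someNotRf ls

  rf : Game → Bool
  rf (mk _ b _ rs) = b ∨ null rs ∨ someNotLf rs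

  someNotRf : List Game → Bool
  someNotRf []       = false
  someNotRf (g ∷ gs) = not (rf g) ∨ someNotRf gs

  someNotLf : List Game → Bool
  someNotLf []       = false
  someNotLf (g ∷ gs) = not (lf g) ∨ someNotLf gs

data Outcome : Set where
  𝓛 𝓝 𝓟 𝓡 : Outcome

outcome : Game → Outcome
outcome G with lf G | rf G
... | true  | false = 𝓛
... | true  | true  = 𝓝
... | false | false = 𝓟
... | false | true  = 𝓡

outcomeL outcomeR : Game → Outcome
outcomeL G = if lf G then 𝓛 else 𝓡
outcomeR G = if rf G then 𝓡 else 𝓛

_≥o_ : Outcome → Outcome → Set
𝓛 ≥o _ = ⊤
_ ≥o 𝓡 = ⊤
𝓝 ≥o 𝓝 = ⊤
𝓟 ≥o 𝓟 = ⊤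
_ ≥o _ = ⊥

mutual
  conj : Game → Game
  conj (mk a b ls rs) = mk b a (conjs rs) (conjs ls)

  conjs : List Game → List Game
  conjs []       = []
  conjs (g ∷ gs) = conj g ∷ conjs gs

-- Disjunctive sum of augmented forms (Siegel): the sum has a Left
-- tombstone iff both summands are Left end-like and at least one of them
-- has a Left tombstone; symmetrically for Right.

mutual
  infixl 6 _⊕_
  _⊕_ : Game → Game → Game
  mk a b gl gr ⊕ mk c d hl hr =
    mk ((leftEndLikeᵇ (mk a b gl gr) ∧ leftEndLikeᵇ (mk c d hl hr)) ∧ (a ∨ c))
       ((rightEndLikeᵇ (mk a b gl gr) ∧ rightEndLikeᵇ (mk c d hl hr)) ∧ (b ∨ d))
       (sumL gl (mk c d hl hr) ++ sumR (mk a b gl gr) hl)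
       (sumL gr (mk c d hl hr) ++ sumR (mk a b gl gr) hr)

  sumL : List Game → Game → List Game
  sumL []       H = []
  sumL (g ∷ gs) H = (g ⊕ H) ∷ sumL gs H

  sumR : Game → List Game → List Game
  sumR G []       = []
  sumR G (h ∷ hs) = (G ⊕ h) ∷ sumR G hs

zeroG : Game
zeroG = mk false false [] []

nat : ℕ → Game
nat zero    = zeroG
nat (suc n) = mk false false (nat n ∷ []) []

_+ⁿ_ : Game → ℕ → Game
G +ⁿ n = G ⊕ nat n

_-ⁿ_ : Game → ℕ → Game
G -ⁿ n = G ⊕ conj (nat n)

data Subpos : Game → Game → Set where
  here  : ∀ {G} → Subpos G G
  viaL  : ∀ {H G G′} → G′ ∈ leftOpts G  → Subpos H G′ → Subpos H G
  viaR  : ∀ {H G G′} → G′ ∈ rightOpts G → Subpos H G′ → Subpos H G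

StrictlyPFree : Game → Set
StrictlyPFree G = ∀ H → Subpos H G → ¬ (outcome H ≡ 𝓟)

GameSet : Set₁
GameSet = Game → Set

PFreePart : GameSet → GameSet
PFreePart A G = A G × StrictlyPFree G

_≥[_]_ : Game → GameSet → Game → Set
G ≥[ A ] H = ∀ X → A X → outcome (G ⊕ X) ≥o outcome (H ⊕ X)

_≡[_]_ : Game → GameSet → Game → Set
G ≡[ A ] H = (G ≥[ A ] H) × (H ≥[ A ] G)

IsMonoidOfGames : GameSet → Set
IsMonoidOfGames A =
  Σ Game A
  × (∀ G H → A G → A H → A (G ⊕ H))
  × Σ Game (λ E → A E × (∀ G → A G → (G ⊕ E) ≡[ A ] G))

Hereditary : GameSet → Set
Hereditary A = ∀ G → A G → ∀ G′ → (G′ ∈ leftOpts G ⊎ G′ ∈ rightOpts G) → A G′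

IntegerInvertible : GameSet → Set
IntegerInvertible A =
  ∀ n → A (nat n) × A (conj (nat n)) × ((nat n ⊕ conj (nat n)) ≡[ A ] zeroG)

OutcomeStable : GameSet → Set
OutcomeStable A = ∀ G H → PFreePart A G → PFreePart A H →
    (outcome G ≡ 𝓛 → outcome H ≡ 𝓛 → outcome (G ⊕ H) ≡ 𝓛)
  × (outcome G ≡ 𝓡 → outcome H ≡ 𝓡 → outcome (G ⊕ H) ≡ 𝓡)
  × (outcome G ≡ 𝓛 → outcome H ≡ 𝓝 → outcomeL (G ⊕ H) ≡ 𝓛)
  × (outcome G ≡ 𝓡 → outcome H ≡ 𝓝 → outcomeR (G ⊕ H) ≡ 𝓡)

IsLtp : Game → ℕ → Set
IsLtp G m = outcome (G -ⁿ m) ≡ 𝓛 × (∀ k → k < m → ¬ (outcome (G -ⁿ k) ≡ 𝓛))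

IsRtp : Game → ℕ → Set
IsRtp G m = outcome (G +ⁿ m) ≡ 𝓡 × (∀ k → k < m → ¬ (outcome (G +ⁿ k) ≡ 𝓡))

PropertyX : GameSet → Set
PropertyX A = ∀ G H → PFreePart A G → PFreePart A H →
    outcome G ≡ 𝓝 → outcome H ≡ 𝓝 →
    (IsRtp G 1 → IsLtp H 1 → LeftEndLike G → ¬ LeftEndLike H →
       outcome (G ⊕ H) ≡ 𝓝)
  × (IsLtp G 1 → IsRtp H 1 → RightEndLike H → ¬ RightEndLike G →
       outcome (G ⊕ H) ≡ 𝓝)

{-# OPTIONS --safe #-}
-- Integers being invertible, G + H has the outcome of (G + k) + (H − k) for every integer k.
-- The heart of the matter is a key lemma: for strictly 𝓟-free G and H, if Left wins moving first
-- on G + k and Right loses moving first on H − k − 1, then Left wins moving first on G + H.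
-- Stability settles it unless G + k and H − k are both 𝓝 with G + k + 1 in 𝓡 and H − k − 1 in 𝓛.
-- In that case, if G + k is Left end-like, Property X applies; if Left wins G + k by a move to
-- g + k, then after the move to g + H every answer of Right satisfies the hypotheses of the key
-- lemma again; and if Left wins by moving in the integer k, the roles of G and H can be exchanged.
-- Now suppose Left loses moving first on G + H, and let k be the last integer such that Left wins
-- moving first on G + k. Then G + k + 1 is 𝓡, while H − k − 1 is not 𝓛 by the key lemma, so by
-- stability Right wins moving first on G + H, which is therefore not 𝓟.
module Submission where

open import Defs
open import Data.Product using (_×_)
open import Algebra.Bundles using (CommutativeMonoid)
import Algebra.Properties.CommutativeSemigroup as CommutativeSemigroupProperties
open import Data.Bool using (Bool; true; false; _∨_; _∧_)
open import Data.Bool.Properties using (∨-assoc; ∨-comm; ∧-comm; ∧-zeroʳ; ∨-zeroʳ)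
open import Data.Empty using (⊥; ⊥-elim)
open import Data.Integer using (ℤ; +_; -[1+_])
open import Data.List using (List; []; _∷_; _++_; null; map)
open import Data.List.Membership.Propositional using (_∈_)
open import Data.List.Membership.Propositional.Properties using (∈-map⁺; ∈-map⁻; ∈-++⁺ˡ; ∈-++⁺ʳ; ∈-++⁻)
open import Data.List.Properties using (++-assoc; ++-identityʳ)
open import Data.List.Relation.Unary.Any using (here; there)
open import Data.Nat using (ℕ; zero; suc; _+_; _≤_; _<_; s≤s)
open import Data.Nat.Induction using (<-wellFounded)
open import Data.Nat.Properties using (≤-refl; ≤-trans; ≤-pred; <-trans; <⇒≤; m≤m+n; m≤n⇒m≤1+n; m≤n⇒m≤n+o; m≤n⇒m≤o+n; +-monoˡ-<; +-mono-<; +-comm)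
open import Data.Product using (∃-syntax; _,_; proj₁; proj₂)
open import Data.Sum using (_⊎_; inj₁; inj₂)
open import Function using (_on_; _∘_)
open import Induction.WellFounded using (Acc; acc; WellFounded)
open import Relation.Binary.Construct.On using () renaming (wellFounded to on-wellFounded)
open import Relation.Binary.PropositionalEquality using (_≡_; refl; sym; trans; cong; cong₂; subst; module ≡-Reasoning)
open import Relation.Nullary using (¬_)

-- Case analysis on Booleans.

true≢false : {b : Bool} → b ≡ true → b ≡ false → ⊥
true≢false refl ()

dichotomy : (b : Bool) → b ≡ true ⊎ b ≡ false
dichotomy true  = inj₁ refl
dichotomy false = inj₂ refl

¬true⇒false : {b : Bool} → ¬ (b ≡ true) → b ≡ false
¬true⇒false {true}  n = ⊥-elim (n refl)
¬true⇒false {false} _ = refl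

¬false⇒true : {b : Bool} → ¬ (b ≡ false) → b ≡ true
¬false⇒true {true}  _ = refl
¬false⇒true {false} n = ⊥-elim (n refl)

⇔⇒≡ : {a b : Bool} → (a ≡ true → b ≡ true) → (b ≡ true → a ≡ true) → a ≡ b
⇔⇒≡ {true}          f _ = sym (f refl)
⇔⇒≡ {false} {true}  _ g = g refl
⇔⇒≡ {false} {false} _ _ = refl

-- Moves and winning, uniformly in the player

data Side : Set where
  left right : Side

opp : Side → Side
opp left  = right
opp right = left

tomb end wins : Side → Game → Bool
tomb left  = leftTomb
tomb right = rightTomb
end left  = leftEndLikeᵇ
end right = rightEndLikeᵇ
wins left  = lf
wins right = rf

opts : Side → Game → List Game
opts left  = leftOpts
opts right = rightOpts

tomb⇒end : ∀ s G → tomb s G ≡ true → end s G ≡ true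
tomb⇒end left  (mk _ _ _ _) refl = refl
tomb⇒end right (mk _ _ _ _) refl = refl

[]⇒end : ∀ s G → opts s G ≡ [] → end s G ≡ true
[]⇒end left  (mk a _ _ _) refl = ∨-zeroʳ a
[]⇒end right (mk _ b _ _) refl = ∨-zeroʳ b

end⇒ : ∀ s G → end s G ≡ true → tomb s G ≡ true ⊎ opts s G ≡ []
end⇒ left  (mk true  _ _ _)     _ = inj₁ refl
end⇒ left  (mk false _ [] _)    _ = inj₂ refl
end⇒ right (mk _ true  _ _)     _ = inj₁ refl
end⇒ right (mk _ false _ [])    _ = inj₂ refl

end⇒wins : ∀ s G → end s G ≡ true → wins s G ≡ true
end⇒wins left  (mk true  _ _ _)  _ = refl
end⇒wins left  (mk false _ [] _) _ = refl
end⇒wins right (mk _ true  _ _)  _ = refl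
end⇒wins right (mk _ false _ []) _ = refl

someNotRf⁺ : ∀ {g gs} → g ∈ gs → rf g ≡ false → someNotRf gs ≡ true
someNotRf⁺ (here refl) e rewrite e = refl
someNotRf⁺ {gs = g ∷ _} (there m) e rewrite someNotRf⁺ m e = ∨-zeroʳ _

someNotLf⁺ : ∀ {g gs} → g ∈ gs → lf g ≡ false → someNotLf gs ≡ true
someNotLf⁺ (here refl) e rewrite e = refl
someNotLf⁺ {gs = g ∷ _} (there m) e rewrite someNotLf⁺ m e = ∨-zeroʳ _

someNotRf⁻ : ∀ gs → someNotRf gs ≡ true → ∃[ g ] g ∈ gs × rf g ≡ false
someNotRf⁻ (g ∷ gs) e with rf g in eq
... | false = g , here refl , eq
... | true  = let h , m , p = someNotRf⁻ gs e in h , there m , p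

someNotLf⁻ : ∀ gs → someNotLf gs ≡ true → ∃[ g ] g ∈ gs × lf g ≡ false
someNotLf⁻ (g ∷ gs) e with lf g in eq
... | false = g , here refl , eq
... | true  = let h , m , p = someNotLf⁻ gs e in h , there m , p

move⇒wins : ∀ s G {g} → g ∈ opts s G → wins (opp s) g ≡ false → wins s G ≡ true
move⇒wins left  (mk a _ ls _) m e rewrite someNotRf⁺ m e | ∨-zeroʳ (null ls) = ∨-zeroʳ a
move⇒wins right (mk _ b _ rs) m e rewrite someNotLf⁺ m e | ∨-zeroʳ (null rs) = ∨-zeroʳ b

wins⇒ : ∀ s G → wins s G ≡ true →
  end s G ≡ true ⊎ ∃[ g ] g ∈ opts s G × wins (opp s) g ≡ false
wins⇒ left  (mk true  _ _ _)        _ = inj₁ refl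
wins⇒ left  (mk false _ [] _)       _ = inj₁ refl
wins⇒ left  (mk false _ (l ∷ ls) _) e = inj₂ (someNotRf⁻ (l ∷ ls) e)
wins⇒ right (mk _ true  _ _)        _ = inj₁ refl
wins⇒ right (mk _ false _ [])       _ = inj₁ refl
wins⇒ right (mk _ false _ (r ∷ rs)) e = inj₂ (someNotLf⁻ (r ∷ rs) e)

loses⇒opp-wins : ∀ s G {g} → wins s G ≡ false → g ∈ opts s G → wins (opp s) g ≡ true
loses⇒opp-wins s G l m = ¬false⇒true λ e → true≢false (move⇒wins s G m e) l

loses : ∀ s G → end s G ≡ false → (∀ {g} → g ∈ opts s G → wins (opp s) g ≡ true) →
  wins s G ≡ false
loses s G ne f = ¬true⇒false λ w → refute (wins⇒ s G w)
  where
  refute : end s G ≡ true ⊎ (∃[ g ] g ∈ opts s G × wins (opp s) g ≡ false) → ⊥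
  refute (inj₁ e)           = true≢false e ne
  refute (inj₂ (g , m , l)) = true≢false (f m) l

-- Size of a form, the measure for well-founded recursion.

mutual
  size : Game → ℕ
  size (mk _ _ ls rs) = suc (sizes ls + sizes rs)

  sizes : List Game → ℕ
  sizes []       = 0
  sizes (g ∷ gs) = size g + sizes gs

∈⇒size≤ : ∀ {g gs} → g ∈ gs → size g ≤ sizes gs
∈⇒size≤ (here refl) = m≤m+n _ _
∈⇒size≤ (there m)   = m≤n⇒m≤o+n _ (∈⇒size≤ m)

size-opts : ∀ s G {g} → g ∈ opts s G → size g < size G
size-opts left  (mk _ _ _ _)  m = s≤s (m≤n⇒m≤n+o _ (∈⇒size≤ m))
size-opts right (mk _ _ ls _) m = s≤s (m≤n⇒m≤o+n (sizes ls) (∈⇒size≤ m))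

Smaller : Game → Game → Set
Smaller = _<_ on size

smaller-wellFounded : WellFounded Smaller
smaller-wellFounded = on-wellFounded size <-wellFounded

-- Disjunctive sums

sumL≡map : ∀ gs H → sumL gs H ≡ map (_⊕ H) gs
sumL≡map []       H = refl
sumL≡map (g ∷ gs) H = cong (_ ∷_) (sumL≡map gs H)

sumR≡map : ∀ G hs → sumR G hs ≡ map (G ⊕_) hs
sumR≡map G []       = refl
sumR≡map G (h ∷ hs) = cong (_ ∷_) (sumR≡map G hs)

opts-⊕ : ∀ s G H → opts s (G ⊕ H) ≡ map (_⊕ H) (opts s G) ++ map (G ⊕_) (opts s H)
opts-⊕ left  G@(mk _ _ gl _) H@(mk _ _ hl _) = cong₂ _++_ (sumL≡map gl H) (sumR≡map G hl)
opts-⊕ right G@(mk _ _ _ gr) H@(mk _ _ _ hr) = cong₂ _++_ (sumL≡map gr H) (sumR≡map G hr)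

∈-⊕ˡ : ∀ s G H {g} → g ∈ opts s G → g ⊕ H ∈ opts s (G ⊕ H)
∈-⊕ˡ s G H m = subst (_ ∈_) (sym (opts-⊕ s G H)) (∈-++⁺ˡ (∈-map⁺ (_⊕ H) m))

∈-⊕ʳ : ∀ s G H {h} → h ∈ opts s H → G ⊕ h ∈ opts s (G ⊕ H)
∈-⊕ʳ s G H m = subst (_ ∈_) (sym (opts-⊕ s G H)) (∈-++⁺ʳ _ (∈-map⁺ (G ⊕_) m))

∈-⊕⁻ : ∀ s G H {K} → K ∈ opts s (G ⊕ H) →
  (∃[ g ] g ∈ opts s G × K ≡ g ⊕ H) ⊎ (∃[ h ] h ∈ opts s H × K ≡ G ⊕ h)
∈-⊕⁻ s G H m with ∈-++⁻ (map (_⊕ H) (opts s G)) (subst (_ ∈_) (opts-⊕ s G H) m)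
... | inj₁ p = inj₁ (∈-map⁻ (_⊕ H) p)
... | inj₂ p = inj₂ (∈-map⁻ (G ⊕_) p)

tomb-⊕ : ∀ s G H → tomb s (G ⊕ H) ≡ (end s G ∧ end s H) ∧ (tomb s G ∨ tomb s H)
tomb-⊕ left  (mk _ _ _ _) (mk _ _ _ _) = refl
tomb-⊕ right (mk _ _ _ _) (mk _ _ _ _) = refl

-- If both summands are end-like, either one has a tombstone, which the sum inherits, or both option
-- lists are empty. A summand that is not end-like has an option and no tombstone, so the sum has an
-- option and no tombstone either.
end-⊕ : ∀ s G H → end s (G ⊕ H) ≡ end s G ∧ end s H
end-⊕ left (mk false _ []      _) (mk false _ []      _) = refl
end-⊕ left (mk false _ []      _) (mk false _ (_ ∷ _) _) = refl
end-⊕ left (mk false _ []      _) (mk true  _ _       _) = refl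
end-⊕ left (mk false _ (_ ∷ _) _) (mk _     _ _       _) = refl
end-⊕ left (mk true  _ _       _) (mk true  _ _       _) = refl
end-⊕ left (mk true  _ _       _) (mk false _ []      _) = refl
end-⊕ left (mk true  _ []      _) (mk false _ (_ ∷ _) _) = refl
end-⊕ left (mk true  _ (_ ∷ _) _) (mk false _ (_ ∷ _) _) = refl
end-⊕ right (mk _ false _ []     ) (mk _ false _ []     ) = refl
end-⊕ right (mk _ false _ []     ) (mk _ false _ (_ ∷ _)) = refl
end-⊕ right (mk _ false _ []     ) (mk _ true  _ _      ) = refl
end-⊕ right (mk _ false _ (_ ∷ _)) (mk _ _     _ _      ) = refl
end-⊕ right (mk _ true  _ _      ) (mk _ true  _ _      ) = refl
end-⊕ right (mk _ true  _ _      ) (mk _ false _ []     ) = refl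
end-⊕ right (mk _ true  _ []     ) (mk _ false _ (_ ∷ _)) = refl
end-⊕ right (mk _ true  _ (_ ∷ _)) (mk _ false _ (_ ∷ _)) = refl

-- Here `x`, `y`, `z` stand for end-likeness and `a`, `b`, `c` for tombstones. Either bracketing
-- says that all three games are end-like and at least one has a tombstone.
tomb-assoc : ∀ x y z a b c →
  ((x ∧ y) ∧ z) ∧ (((x ∧ y) ∧ (a ∨ b)) ∨ c) ≡ (x ∧ (y ∧ z)) ∧ (a ∨ ((y ∧ z) ∧ (b ∨ c)))
tomb-assoc false _     _     _ _ _ = refl
tomb-assoc true  false _     _ _ _ = refl
tomb-assoc true  true  false _ _ _ = refl
tomb-assoc true  true  true  a b c = ∨-assoc a b c

sumL-++ : ∀ gs hs K → sumL (gs ++ hs) K ≡ sumL gs K ++ sumL hs K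
sumL-++ []       hs K = refl
sumL-++ (g ∷ gs) hs K = cong (_ ∷_) (sumL-++ gs hs K)

sumR-++ : ∀ G hs ks → sumR G (hs ++ ks) ≡ sumR G hs ++ sumR G ks
sumR-++ G []       ks = refl
sumR-++ G (h ∷ hs) ks = cong (_ ∷_) (sumR-++ G hs ks)

mk-cong : ∀ {a a′ b b′ ls ls′ rs rs′} → a ≡ a′ → b ≡ b′ → ls ≡ ls′ → rs ≡ rs′ →
  mk a b ls rs ≡ mk a′ b′ ls′ rs′
mk-cong refl refl refl refl = refl

tomb-⊕-assoc : ∀ s G H K → tomb s ((G ⊕ H) ⊕ K) ≡ tomb s (G ⊕ (H ⊕ K))
tomb-⊕-assoc s G H K
  rewrite tomb-⊕ s (G ⊕ H) K | tomb-⊕ s G (H ⊕ K) | tomb-⊕ s G H | tomb-⊕ s H K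
        | end-⊕ s G H | end-⊕ s H K
  = tomb-assoc (end s G) (end s H) (end s K) (tomb s G) (tomb s H) (tomb s K)

mutual
  -- Both bracketings list the moves in `G`, then in `H`, then in `K`, so the forms are literally
  -- equal. Commutativity permutes the lists and therefore holds below only up to `_≈_`.
  ⊕-assoc : ∀ G H K → (G ⊕ H) ⊕ K ≡ G ⊕ (H ⊕ K)
  ⊕-assoc G@(mk _ _ gl gr) H@(mk _ _ hl hr) K@(mk _ _ kl kr) =
    mk-cong (tomb-⊕-assoc left G H K) (tomb-⊕-assoc right G H K)
            (opts-assoc G H K gl hl kl) (opts-assoc G H K gr hr kr)

  opts-assoc : ∀ G H K gs hs ks →
    sumL (sumL gs H ++ sumR G hs) K ++ sumR (G ⊕ H) ks
      ≡ sumL gs (H ⊕ K) ++ sumR G (sumL hs K ++ sumR H ks)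
  opts-assoc G H K gs hs ks
    rewrite sumL-++ (sumL gs H) (sumR G hs) K | sumR-++ G (sumL hs K) (sumR H ks)
          | ++-assoc (sumL (sumL gs H) K) (sumL (sumR G hs) K) (sumR (G ⊕ H) ks)
    = cong₂ _++_ (sumL-sumL gs H K) (cong₂ _++_ (sumL-sumR G hs K) (sumR-sumR G H ks))

  sumL-sumL : ∀ gs H K → sumL (sumL gs H) K ≡ sumL gs (H ⊕ K)
  sumL-sumL []       H K = refl
  sumL-sumL (g ∷ gs) H K = cong₂ _∷_ (⊕-assoc g H K) (sumL-sumL gs H K)

  sumL-sumR : ∀ G hs K → sumL (sumR G hs) K ≡ sumR G (sumL hs K)
  sumL-sumR G []       K = refl
  sumL-sumR G (h ∷ hs) K = cong₂ _∷_ (⊕-assoc G h K) (sumL-sumR G hs K)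

  sumR-sumR : ∀ G H ks → sumR (G ⊕ H) ks ≡ sumR G (sumR H ks)
  sumR-sumR G H []       = refl
  sumR-sumR G H (k ∷ ks) = cong₂ _∷_ (⊕-assoc G H k) (sumR-sumR G H ks)

∨-∧-absorb : ∀ a b → ((a ∨ b) ∧ true) ∧ (a ∨ false) ≡ a
∨-∧-absorb true  _ = refl
∨-∧-absorb false b = ∧-zeroʳ _

mutual
  ⊕-identityʳ : ∀ G → G ⊕ zeroG ≡ G
  ⊕-identityʳ (mk a b ls rs) =
    mk-cong (∨-∧-absorb a (null ls)) (∨-∧-absorb b (null rs))
            (trans (++-identityʳ _) (sumL-zero ls)) (trans (++-identityʳ _) (sumL-zero rs))

  sumL-zero : ∀ gs → sumL gs zeroG ≡ gs
  sumL-zero []       = refl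
  sumL-zero (g ∷ gs) = cong₂ _∷_ (⊕-identityʳ g) (sumL-zero gs)

-- Bisimilarity: equality of forms up to order and repetition of options

infix 4 _≈_
data _≈_ : Game → Game → Set where
  bisim : ∀ {G H} →
    (∀ s → tomb s G ≡ tomb s H) →
    (∀ s {g} → g ∈ opts s G → ∃[ h ] h ∈ opts s H × g ≈ h) →
    (∀ s {h} → h ∈ opts s H → ∃[ g ] g ∈ opts s G × g ≈ h) →
    G ≈ H

≈-refl′ : ∀ {G} → Acc Smaller G → G ≈ G
≈-refl′ {G} (acc rs) = bisim (λ _ → refl)
  (λ s m → _ , m , ≈-refl′ (rs (size-opts s G m)))
  (λ s m → _ , m , ≈-refl′ (rs (size-opts s G m)))

≈-refl : ∀ {G} → G ≈ G
≈-refl {G} = ≈-refl′ (smaller-wellFounded G)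

≡⇒≈ : ∀ {G H} → G ≡ H → G ≈ H
≡⇒≈ refl = ≈-refl

≈-sym′ : ∀ {G H} → Acc Smaller G → G ≈ H → H ≈ G
≈-sym′ {G} (acc rs) (bisim t f b) = bisim (λ s → sym (t s))
  (λ s m → let g , n , e = b s m in g , n , ≈-sym′ (rs (size-opts s G n)) e)
  (λ s m → let h , n , e = f s m in h , n , ≈-sym′ (rs (size-opts s G m)) e)

≈-sym : ∀ {G H} → G ≈ H → H ≈ G
≈-sym = ≈-sym′ (smaller-wellFounded _)

≈-trans′ : ∀ {G H K} → Acc Smaller G → G ≈ H → H ≈ K → G ≈ K
≈-trans′ {G} (acc rs) (bisim t f b) (bisim t′ f′ b′) = bisim (λ s → trans (t s) (t′ s))
  (λ s m → let h , n , e = f s m ; k , o , e′ = f′ s n in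
           k , o , ≈-trans′ (rs (size-opts s G m)) e e′)
  (λ s m → let h , n , e′ = b′ s m ; g , o , e = b s n in
           g , o , ≈-trans′ (rs (size-opts s G o)) e e′)

≈-trans : ∀ {G H K} → G ≈ H → H ≈ K → G ≈ K
≈-trans = ≈-trans′ (smaller-wellFounded _)

∉[] : ∀ {A : Set} (xs : List A) → (∀ {x} → ¬ (x ∈ xs)) → xs ≡ []
∉[] []      _ = refl
∉[] (x ∷ _) n = ⊥-elim (n (here refl))

-- Tombstones agree by definition. If `G` has no options, an option of `H` would have a partner in
-- an empty list.
end-≈⇒ : ∀ s {G H} → G ≈ H → end s G ≡ true → end s H ≡ true
end-≈⇒ s {G} {H} (bisim t _ b) e with end⇒ s G e
... | inj₁ p = tomb⇒end s H (trans (sym (t s)) p)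
... | inj₂ p = []⇒end s H (∉[] _ λ m → noOption (subst (_ ∈_) p (proj₁ (proj₂ (b s m)))))
  where
  noOption : ∀ {x : Game} → ¬ (x ∈ [])
  noOption ()

end-≈ : ∀ s {G H} → G ≈ H → end s G ≡ end s H
end-≈ s e = ⇔⇒≡ (end-≈⇒ s e) (end-≈⇒ s (≈-sym e))

wins-≈′ : ∀ s {G H} → Acc Smaller G → G ≈ H → wins s G ≡ wins s H
wins-≈′ s {G} {H} (acc rs) e@(bisim _ f b) = ⇔⇒≡ to from
  where
  to : wins s G ≡ true → wins s H ≡ true
  to w with wins⇒ s G w
  ... | inj₁ p = end⇒wins s H (end-≈⇒ s e p)
  ... | inj₂ (g , m , l) = let h , n , e′ = f s m in
    move⇒wins s H n (trans (sym (wins-≈′ (opp s) (rs (size-opts s G m)) e′)) l)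
  from : wins s H ≡ true → wins s G ≡ true
  from w with wins⇒ s H w
  ... | inj₁ p = end⇒wins s G (end-≈⇒ s (≈-sym e) p)
  ... | inj₂ (h , m , l) = let g , n , e′ = b s m in
    move⇒wins s G n (trans (wins-≈′ (opp s) (rs (size-opts s G n)) e′) l)

wins-≈ : ∀ s {G H} → G ≈ H → wins s G ≡ wins s H
wins-≈ s = wins-≈′ s (smaller-wellFounded _)

⊕-comm′ : ∀ {G H} → Acc Smaller G → Acc Smaller H → G ⊕ H ≈ H ⊕ G
⊕-comm′ {G} {H} (acc rs) (acc rs′) = bisim tombs forth back
  where
  tombs : ∀ s → tomb s (G ⊕ H) ≡ tomb s (H ⊕ G)
  tombs s rewrite tomb-⊕ s G H | tomb-⊕ s H G =
    cong₂ _∧_ (∧-comm (end s G) (end s H)) (∨-comm (tomb s G) (tomb s H))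
  forth : ∀ s {k} → k ∈ opts s (G ⊕ H) → ∃[ k′ ] k′ ∈ opts s (H ⊕ G) × k ≈ k′
  forth s m with ∈-⊕⁻ s G H m
  ... | inj₁ (g , n , refl) = _ , ∈-⊕ʳ s H G n , ⊕-comm′ (rs (size-opts s G n)) (acc rs′)
  ... | inj₂ (h , n , refl) = _ , ∈-⊕ˡ s H G n , ⊕-comm′ (acc rs) (rs′ (size-opts s H n))
  back : ∀ s {k′} → k′ ∈ opts s (H ⊕ G) → ∃[ k ] k ∈ opts s (G ⊕ H) × k ≈ k′
  back s m with ∈-⊕⁻ s H G m
  ... | inj₁ (h , n , refl) = _ , ∈-⊕ʳ s G H n , ⊕-comm′ (acc rs) (rs′ (size-opts s H n))
  ... | inj₂ (g , n , refl) = _ , ∈-⊕ˡ s G H n , ⊕-comm′ (rs (size-opts s G n)) (acc rs′)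

⊕-comm : ∀ G H → G ⊕ H ≈ H ⊕ G
⊕-comm G H = ⊕-comm′ (smaller-wellFounded G) (smaller-wellFounded H)

⊕-congʳ′ : ∀ {G G′ H} → Acc Smaller G → Acc Smaller H → G ≈ G′ → G ⊕ H ≈ G′ ⊕ H
⊕-congʳ′ {G} {G′} {H} (acc rs) (acc rs′) e@(bisim t f b) = bisim tombs forth back
  where
  tombs : ∀ s → tomb s (G ⊕ H) ≡ tomb s (G′ ⊕ H)
  tombs s rewrite tomb-⊕ s G H | tomb-⊕ s G′ H | end-≈ s e | t s = refl
  forth : ∀ s {k} → k ∈ opts s (G ⊕ H) → ∃[ k′ ] k′ ∈ opts s (G′ ⊕ H) × k ≈ k′
  forth s m with ∈-⊕⁻ s G H m
  ... | inj₁ (g , n , refl) = let g′ , n′ , e′ = f s n in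
    _ , ∈-⊕ˡ s G′ H n′ , ⊕-congʳ′ (rs (size-opts s G n)) (acc rs′) e′
  ... | inj₂ (h , n , refl) = _ , ∈-⊕ʳ s G′ H n , ⊕-congʳ′ (acc rs) (rs′ (size-opts s H n)) e
  back : ∀ s {k′} → k′ ∈ opts s (G′ ⊕ H) → ∃[ k ] k ∈ opts s (G ⊕ H) × k ≈ k′
  back s m with ∈-⊕⁻ s G′ H m
  ... | inj₁ (g′ , n′ , refl) = let g , n , e′ = b s n′ in
    _ , ∈-⊕ˡ s G H n , ⊕-congʳ′ (rs (size-opts s G n)) (acc rs′) e′
  ... | inj₂ (h , n , refl) = _ , ∈-⊕ʳ s G H n , ⊕-congʳ′ (acc rs) (rs′ (size-opts s H n)) e

⊕-congʳ : ∀ {G G′} H → G ≈ G′ → G ⊕ H ≈ G′ ⊕ H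
⊕-congʳ H = ⊕-congʳ′ (smaller-wellFounded _) (smaller-wellFounded H)

⊕-congˡ : ∀ G {H H′} → H ≈ H′ → G ⊕ H ≈ G ⊕ H′
⊕-congˡ G {H} {H′} e = ≈-trans (⊕-comm G H) (≈-trans (⊕-congʳ G e) (⊕-comm H′ G))

⊕-commutativeMonoid : CommutativeMonoid _ _
⊕-commutativeMonoid = record
  { Carrier = Game ; _≈_ = _≈_ ; _∙_ = _⊕_ ; ε = zeroG
  ; isCommutativeMonoid = record
    { isMonoid = record
      { isSemigroup = record
        { isMagma = record
          { isEquivalence = record { refl = ≈-refl ; sym = ≈-sym ; trans = ≈-trans }
          ; ∙-cong = λ {x} {y} {u} {v} e e′ → ≈-trans (⊕-congʳ u e) (⊕-congˡ y e′)
          }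
        ; assoc = λ x y z → ≡⇒≈ (⊕-assoc x y z)
        }
      ; identity = (λ x → ≈-trans (⊕-comm zeroG x) (≡⇒≈ (⊕-identityʳ x)))
                 , (λ x → ≡⇒≈ (⊕-identityʳ x))
      }
    ; comm = ⊕-comm
    }
  }

open CommutativeSemigroupProperties
  (CommutativeMonoid.commutativeSemigroup ⊕-commutativeMonoid) using (interchange)

-- Outcomes and subpositions

outcome-𝓛 : ∀ G → lf G ≡ true → rf G ≡ false → outcome G ≡ 𝓛
outcome-𝓛 G p q rewrite p | q = refl

outcome-𝓝 : ∀ G → lf G ≡ true → rf G ≡ true → outcome G ≡ 𝓝
outcome-𝓝 G p q rewrite p | q = refl

outcome-𝓟 : ∀ G → lf G ≡ false → rf G ≡ false → outcome G ≡ 𝓟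
outcome-𝓟 G p q rewrite p | q = refl

outcome-𝓡 : ∀ G → lf G ≡ false → rf G ≡ true → outcome G ≡ 𝓡
outcome-𝓡 G p q rewrite p | q = refl

leftWins rightWins : Outcome → Bool
leftWins 𝓛 = true
leftWins 𝓝 = true
leftWins 𝓟 = false
leftWins 𝓡 = false
rightWins 𝓛 = false
rightWins 𝓝 = true
rightWins 𝓟 = false
rightWins 𝓡 = true

lf-outcome : ∀ G → lf G ≡ leftWins (outcome G)
lf-outcome G with lf G | rf G
... | true  | false = refl
... | true  | true  = refl
... | false | false = refl
... | false | true  = refl

rf-outcome : ∀ G → rf G ≡ rightWins (outcome G)
rf-outcome G with lf G | rf G
... | true  | false = refl
... | true  | true  = refl
... | false | false = refl
... | false | true  = refl

wins-outcome : ∀ s {G H} → outcome G ≡ outcome H → wins s G ≡ wins s H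
wins-outcome left  {G} {H} e = trans (lf-outcome G) (trans (cong leftWins e) (sym (lf-outcome H)))
wins-outcome right {G} {H} e = trans (rf-outcome G) (trans (cong rightWins e) (sym (rf-outcome H)))

outcome-cong : ∀ {G H} → (∀ s → wins s G ≡ wins s H) → outcome G ≡ outcome H
outcome-cong {G} {H} e with lf G | rf G | lf H | rf H | e left | e right
... | true  | false | _ | _ | refl | refl = refl
... | true  | true  | _ | _ | refl | refl = refl
... | false | false | _ | _ | refl | refl = refl
... | false | true  | _ | _ | refl | refl = refl

outcomeL-𝓛 : ∀ G → outcomeL G ≡ 𝓛 → lf G ≡ true
outcomeL-𝓛 G e with lf G
... | true = refl

outcomeR-𝓡 : ∀ G → outcomeR G ≡ 𝓡 → rf G ≡ true
outcomeR-𝓡 G e with rf G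
... | true = refl

≥o-refl : ∀ x → x ≥o x
≥o-refl 𝓛 = _
≥o-refl 𝓝 = _
≥o-refl 𝓟 = _
≥o-refl 𝓡 = _

≥o-antisym : ∀ x y → x ≥o y → y ≥o x → x ≡ y
≥o-antisym 𝓛 𝓛 _ _ = refl
≥o-antisym 𝓝 𝓝 _ _ = refl
≥o-antisym 𝓟 𝓟 _ _ = refl
≥o-antisym 𝓡 𝓡 _ _ = refl

wins⇒¬𝓟 : ∀ s G → wins s G ≡ true → ¬ (outcome G ≡ 𝓟)
wins⇒¬𝓟 left  G w e = true≢false w (trans (lf-outcome G) (cong leftWins e))
wins⇒¬𝓟 right G w e = true≢false w (trans (rf-outcome G) (cong rightWins e))

¬𝓟⇒opp-wins : ∀ s G → ¬ (outcome G ≡ 𝓟) → wins s G ≡ false → wins (opp s) G ≡ true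
¬𝓟⇒opp-wins left  G n l = ¬false⇒true λ e → n (outcome-𝓟 G l e)
¬𝓟⇒opp-wins right G n l = ¬false⇒true λ e → n (outcome-𝓟 G e l)

via : ∀ s {K G g} → g ∈ opts s G → Subpos K g → Subpos K G
via left  = viaL
via right = viaR

subpos-trans : ∀ {G H K} → Subpos K H → Subpos H G → Subpos K G
subpos-trans p here       = p
subpos-trans p (viaL m q) = viaL m (subpos-trans p q)
subpos-trans p (viaR m q) = viaR m (subpos-trans p q)

subpos-⊕ : ∀ {K} G H → Subpos K (G ⊕ H) →
  ∃[ G′ ] ∃[ H′ ] Subpos G′ G × Subpos H′ H × K ≡ G′ ⊕ H′
subpos-⊕ {K} G H p = go p refl
  where
  -- The sum is a variable `S` with an equation, so the equation supplied by `∈-⊕⁻` passes straight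
  -- to the recursive call on the shorter path.
  go : ∀ {S G H} → Subpos K S → S ≡ G ⊕ H →
    ∃[ G′ ] ∃[ H′ ] Subpos G′ G × Subpos H′ H × K ≡ G′ ⊕ H′
  step : ∀ s {S G H g} → g ∈ opts s S → Subpos K g → S ≡ G ⊕ H →
    ∃[ G′ ] ∃[ H′ ] Subpos G′ G × Subpos H′ H × K ≡ G′ ⊕ H′
  go here       e = _ , _ , here , here , e
  go (viaL m p) e = step left m p e
  go (viaR m p) e = step right m p e
  step s {G = G} {H} m p refl with ∈-⊕⁻ s G H m
  ... | inj₁ (g , n , e) = let G′ , H′ , a , b , c = go p e in G′ , H′ , via s n a , b , c
  ... | inj₂ (h , n , e) = let G′ , H′ , a , b , c = go p e in G′ , H′ , a , via s n b , c

subpos-≈ : ∀ {G H K} → G ≈ H → Subpos K H → ∃[ K′ ] Subpos K′ G × K′ ≈ K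
subpos-≈ e here = _ , here , e
subpos-≈ (bisim _ _ b) (viaL m p) =
  let g , n , e = b left m ; K′ , q , e′ = subpos-≈ e p in K′ , viaL n q , e′
subpos-≈ (bisim _ _ b) (viaR m p) =
  let g , n , e = b right m ; K′ , q , e′ = subpos-≈ e p in K′ , viaR n q , e′

strictlyPFree-≈ : ∀ {G H} → G ≈ H → StrictlyPFree G → StrictlyPFree H
strictlyPFree-≈ e f K p o = let K′ , q , e′ = subpos-≈ e p in
  f K′ q (trans (outcome-cong (λ s → wins-≈ s e′)) o)

-- Integers

-- A supply of n moves for one player, so that n and its conjugate are treated together.
stack : Side → ℕ → Game
stack left  n = nat n
stack right n = conj (nat n)

-- The sum n + 1 has two options, (n - 1) + 1 and n + 0, both bisimilar to n. The two sides thus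
-- differ by a repeated option, which `_≈_` ignores.
stack-suc : ∀ s n → stack s (suc n) ≈ stack s n ⊕ stack s 1
stack-suc left  zero = ≈-sym (CommutativeMonoid.identityˡ ⊕-commutativeMonoid (nat 1))
stack-suc right zero = ≈-sym (CommutativeMonoid.identityˡ ⊕-commutativeMonoid (conj (nat 1)))
stack-suc left (suc n) = bisim
  (λ { left → refl ; right → refl })
  (λ { left (here refl) → _ , here refl , stack-suc left n })
  (λ { left (here refl) → _ , here refl , stack-suc left n
     ; left (there (here refl)) → _ , here refl , ≈-sym (≡⇒≈ (⊕-identityʳ (nat (suc n)))) })
stack-suc right (suc n) = bisim
  (λ { left → refl ; right → refl })
  (λ { right (here refl) → _ , here refl , stack-suc right n })
  (λ { right (here refl) → _ , here refl , stack-suc right n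
     ; right (there (here refl)) → _ , here refl , ≈-sym (≡⇒≈ (⊕-identityʳ (conj (nat (suc n))))) })

⊕-stack-suc : ∀ s G n → G ⊕ stack s (suc n) ≈ (G ⊕ stack s n) ⊕ stack s 1
⊕-stack-suc s G n =
  ≈-trans (⊕-congˡ G (stack-suc s n)) (≡⇒≈ (sym (⊕-assoc G (stack s n) (stack s 1))))

-- The only move leads to 0, where the opponent has no move and so wins.
stack1-loses : ∀ s → wins s (stack s 1) ≡ false
stack1-loses left  = refl
stack1-loses right = refl

⊕-stack-zero : ∀ s G → G ⊕ stack s 0 ≡ G
⊕-stack-zero left  = ⊕-identityʳ
⊕-stack-zero right = ⊕-identityʳ

zero∈stack1 : ∀ s → stack s 0 ∈ opts s (stack s 1)
zero∈stack1 left  = here refl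
zero∈stack1 right = here refl

subpos-zero : ∀ {K} → Subpos K zeroG → K ≡ zeroG
subpos-zero here = refl

subpos-stack1 : ∀ s {K} → Subpos K (stack s 1) → K ≡ stack s 1 ⊎ K ≡ stack s 0
subpos-stack1 s     here                = inj₁ refl
subpos-stack1 left  (viaL (here refl) p) = inj₂ (subpos-zero p)
subpos-stack1 right (viaR (here refl) p) = inj₂ (subpos-zero p)

int : ℤ → Game
int (+ n)    = stack left n
int -[1+ n ] = stack right (suc n)

-- Together with `reflect` this expresses -k as `next (reflect k)`, by cases on constructors and
-- without integer arithmetic.
next : ℤ → ℤ
next (+ n)        = + suc n
next -[1+ zero ]  = + 0
next -[1+ suc n ] = -[1+ n ]

-- k ↦ − k − 1
reflect : ℤ → ℤ
reflect (+ n)    = -[1+ n ]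
reflect -[1+ n ] = + n

int-next-neg : ∀ n → int (next -[1+ n ]) ≡ stack right n
int-next-neg zero    = refl
int-next-neg (suc n) = refl

leftOpts-int : ∀ k {x} → x ∈ leftOpts (int k) → ∃[ n ] k ≡ + suc n × x ≡ nat n
leftOpts-int (+ suc n) (here refl) = n , refl , refl

-- A natural number has no Right options, so a Right end-like `G` would make the sum Right end-like
-- and hence won by Right.
¬rightEnd-nat : ∀ G n → rf (G ⊕ nat n) ≡ false → end right G ≡ false
¬rightEnd-nat G n l = ¬true⇒false λ e →
  true≢false (end⇒wins right (G ⊕ nat n) (trans (end-⊕ right G (nat n)) (cong₂ _∧_ e (end-nat n)))) l
  where
  end-nat : ∀ n → end right (nat n) ≡ true
  end-nat zero    = refl
  end-nat (suc n) = refl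

-- A long enough supply of Left moves lets Right run out of moves first.
mutual
  right-wins-⊕nat : ∀ {G} → Acc Smaller G → ∀ n → size G ≤ n → rf (G ⊕ nat n) ≡ true
  right-wins-⊕nat {G} (acc rs) n le with dichotomy (end right G)
  ... | inj₁ e = ¬false⇒true λ l → true≢false e (¬rightEnd-nat G n l)
  ... | inj₂ e with rightOpts G in eq
  right-wins-⊕nat {G} (acc rs) n le | inj₂ e | [] =
    ⊥-elim (true≢false ([]⇒end right G eq) e)
  right-wins-⊕nat {G} (acc rs) (suc n) le | inj₂ e | g ∷ _ =
    move⇒wins right (G ⊕ nat (suc n)) (∈-⊕ˡ right G (nat (suc n)) m)
      (left-loses-⊕nat (rs (size-opts right G m)) n (≤-pred (≤-trans (size-opts right G m) le)))
    where
    m : g ∈ rightOpts G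
    m = subst (g ∈_) (sym eq) (here refl)
  right-wins-⊕nat {mk _ _ _ _} (acc rs) zero () | inj₂ e | _ ∷ _

  left-loses-⊕nat : ∀ {G} → Acc Smaller G → ∀ n → size G ≤ n → lf (G ⊕ nat (suc n)) ≡ false
  -- The integer is positive, so Left has a move there and no tombstone: the sum is not Left
  -- end-like, and she has to move.
  left-loses-⊕nat {G} (acc rs) n le = loses left (G ⊕ nat (suc n))
    (trans (end-⊕ left G (nat (suc n))) (∧-zeroʳ (end left G))) replies
    where
    replies : ∀ {g} → g ∈ leftOpts (G ⊕ nat (suc n)) → rf g ≡ true
    replies m with ∈-⊕⁻ left G (nat (suc n)) m
    ... | inj₁ (g , o , refl) = right-wins-⊕nat (rs (size-opts left G o)) (suc n)
      (m≤n⇒m≤1+n (≤-trans (<⇒≤ (size-opts left G o)) le))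
    ... | inj₂ (_ , here refl , refl) = right-wins-⊕nat (acc rs) n le

-- Found by searching downwards from `n`; it locates the integer at which Left stops winning first.
last-true : ∀ (f : ℕ → Bool) n → f 0 ≡ true → f n ≡ false → ∃[ m ] f m ≡ true × f (suc m) ≡ false
last-true f zero    t e = ⊥-elim (true≢false t e)
last-true f (suc n) t e with dichotomy (f n)
... | inj₁ p = n , p , e
... | inj₂ p = last-true f n t p

-- Consequences of heredity and outcome-stability.

module _ (A : GameSet) (closed : ∀ G H → A G → A H → A (G ⊕ H)) (stable : OutcomeStable A)
         (hereditary : Hereditary A) (invertible : IntegerInvertible A) (propX : PropertyX A) where

  P : GameSet
  P = PFreePart A

  A-opts : ∀ s {G g} → A G → g ∈ opts s G → A g
  A-opts left  a m = hereditary _ a _ (inj₁ m)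
  A-opts right a m = hereditary _ a _ (inj₂ m)

  P-opts : ∀ s {G g} → P G → g ∈ opts s G → P g
  P-opts s (a , f) m = A-opts s a m , λ K p → f K (via s m p)

  A-stack : ∀ s n → A (stack s n)
  A-stack left  n = proj₁ (invertible n)
  A-stack right n = proj₁ (proj₂ (invertible n))

  A-subpos : ∀ {G K} → A G → Subpos K G → A K
  A-subpos a here       = a
  A-subpos a (viaL m p) = A-subpos (A-opts left a m) p
  A-subpos a (viaR m p) = A-subpos (A-opts right a m) p

  P-subpos : ∀ {G K} → P G → Subpos K G → P K
  P-subpos (a , f) p = A-subpos a p , λ K q → f K (subpos-trans q p)

  opp-wins : ∀ s {G} → P G → wins s G ≡ false → wins (opp s) G ≡ true
  opp-wins s {G} (_ , f) = ¬𝓟⇒opp-wins s G (f G here)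

  -- Since `U` is not 𝓟, it is a win for `s` whoever starts. Whether `V` is 𝓝 or also such a win, a
  -- clause of stability applies.
  wins-⊕ : ∀ s {U V} → P U → P V → wins (opp s) U ≡ false → wins s V ≡ true →
    wins s (U ⊕ V) ≡ true
  wins-⊕ left {U} {V} pU pV l w with stable U V pU pV | dichotomy (rf V)
  ... | _ , _ , LN , _ | inj₁ e =
    outcomeL-𝓛 (U ⊕ V) (LN (outcome-𝓛 U (opp-wins right pU l) l) (outcome-𝓝 V w e))
  ... | LL , _ | inj₂ e = trans (lf-outcome (U ⊕ V))
    (cong leftWins (LL (outcome-𝓛 U (opp-wins right pU l) l) (outcome-𝓛 V w e)))
  wins-⊕ right {U} {V} pU pV l w with stable U V pU pV | dichotomy (lf V)
  ... | _ , _ , _ , RN | inj₁ e =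
    outcomeR-𝓡 (U ⊕ V) (RN (outcome-𝓡 U l (opp-wins left pU l)) (outcome-𝓝 V e w))
  ... | _ , RR , _ | inj₂ e = trans (rf-outcome (U ⊕ V))
    (cong rightWins (RR (outcome-𝓡 U l (opp-wins left pU l)) (outcome-𝓡 V e w)))

  wins-⊕′ : ∀ s {U V} → P U → P V → wins s U ≡ true → wins (opp s) V ≡ false →
    wins s (U ⊕ V) ≡ true
  wins-⊕′ s {U} {V} pU pV w l = trans (wins-≈ s (⊕-comm U V)) (wins-⊕ s pV pU l w)

  -- Adding integers preserves strict 𝓟-freeness.

  P-stack1 : ∀ s → P (stack s 1)
  P-stack1 s = A-stack s 1 , free s
    where
    free : ∀ s → StrictlyPFree (stack s 1)
    free s K p with subpos-stack1 s p
    free left  _ _ | inj₁ refl = λ ()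
    free left  _ _ | inj₂ refl = λ ()
    free right _ _ | inj₁ refl = λ ()
    free right _ _ | inj₂ refl = λ ()

  wins-⊕stack1 : ∀ s G → wins (opp s) G ≡ false → wins s (G ⊕ stack s 1) ≡ true
  wins-⊕stack1 s G l = move⇒wins s (G ⊕ stack s 1) (∈-⊕ʳ s G (stack s 1) (zero∈stack1 s))
    (trans (cong (wins (opp s)) (⊕-stack-zero s G)) l)

  -- The unit is lost by its owner moving first, so it favours the opponent: if the opponent wins
  -- `G` moving first, stability gives the opponent the sum. Otherwise the owner spends the unit and
  -- wins.
  ⊕stack1-¬𝓟 : ∀ s {G} → P G → ¬ (outcome (G ⊕ stack s 1) ≡ 𝓟)
  ⊕stack1-¬𝓟 s {G} pG with dichotomy (wins (opp s) G)
  ... | inj₁ w = wins⇒¬𝓟 (opp s) (G ⊕ stack s 1)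
    (wins-⊕′ (opp s) pG (P-stack1 s) w (trans (cong (λ t → wins t (stack s 1)) (opp-opp s)) (stack1-loses s)))
    where
    opp-opp : ∀ s → opp (opp s) ≡ s
    opp-opp left  = refl
    opp-opp right = refl
  ... | inj₂ l = wins⇒¬𝓟 s (G ⊕ stack s 1) (wins-⊕stack1 s G l)

  P-⊕stack1 : ∀ s {G} → P G → P (G ⊕ stack s 1)
  P-⊕stack1 s {G} pG = closed _ _ (proj₁ pG) (A-stack s 1) , free
    where
    free : StrictlyPFree (G ⊕ stack s 1)
    free K p with subpos-⊕ G (stack s 1) p
    ... | G′ , H′ , q , q′ , refl with subpos-stack1 s q′
    ... | inj₁ refl = ⊕stack1-¬𝓟 s (P-subpos pG q)
    ... | inj₂ refl = proj₂ pG G′ q ∘ trans (cong outcome (sym (⊕-stack-zero s G′)))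

  P-⊕stack : ∀ s n {G} → P G → P (G ⊕ stack s n)
  P-⊕stack s zero    {G} pG = subst P (sym (⊕-stack-zero s G)) pG
  P-⊕stack s (suc n) {G} pG = closed _ _ (proj₁ pG) (A-stack s (suc n)) ,
    strictlyPFree-≈ (≈-sym (⊕-stack-suc s G n)) (proj₂ (P-⊕stack1 s (P-⊕stack s n pG)))

  P-⊕int : ∀ k {G} → P G → P (G ⊕ int k)
  P-⊕int (+ n)    = P-⊕stack left n
  P-⊕int -[1+ n ] = P-⊕stack right (suc n)

  -- Cancelling and shifting integers.

  ⊕-cancel : ∀ n {X} → A X → ∀ s → wins s (X ⊕ (nat n ⊕ conj (nat n))) ≡ wins s X
  ⊕-cancel n {X} a s = begin
    wins s (X ⊕ (nat n ⊕ conj (nat n)))  ≡⟨ wins-≈ s (⊕-comm X _) ⟩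
    wins s ((nat n ⊕ conj (nat n)) ⊕ X)  ≡⟨ wins-outcome s (≥o-antisym _ _ (proj₁ inv X a) (proj₂ inv X a)) ⟩
    wins s (zeroG ⊕ X)                   ≡⟨ wins-≈ s (CommutativeMonoid.identityˡ ⊕-commutativeMonoid X) ⟩
    wins s X                             ∎
    where
    open ≡-Reasoning
    inv = proj₂ (proj₂ (invertible n))

  ⊕-cancel′ : ∀ n {X} → A X → ∀ s → wins s (X ⊕ (conj (nat n) ⊕ nat n)) ≡ wins s X
  ⊕-cancel′ n {X} a s = trans (wins-≈ s (⊕-congˡ X (⊕-comm (conj (nat n)) (nat n)))) (⊕-cancel n a s)

  wins-next : ∀ k {G} → A G → ∀ s → wins s ((G ⊕ int k) ⊕ nat 1) ≡ wins s (G ⊕ int (next k))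
  wins-next (+ n)    {G} a s = wins-≈ s (≈-sym (⊕-stack-suc left G n))
  wins-next -[1+ n ] {G} a s rewrite int-next-neg n = begin
    wins s ((G ⊕ stack right (suc n)) ⊕ nat 1)                ≡⟨ wins-≈ s (⊕-congʳ (nat 1) (⊕-stack-suc right G n)) ⟩
    wins s (((G ⊕ stack right n) ⊕ stack right 1) ⊕ nat 1)    ≡⟨ cong (wins s) (⊕-assoc (G ⊕ stack right n) (stack right 1) (nat 1)) ⟩
    wins s ((G ⊕ stack right n) ⊕ (stack right 1 ⊕ nat 1))    ≡⟨ ⊕-cancel′ 1 (closed _ _ a (A-stack right n)) s ⟩
    wins s (G ⊕ stack right n)                                ∎
    where open ≡-Reasoning

  wins-prev : ∀ k {G} → A G → ∀ s → wins s ((G ⊕ int (next k)) ⊕ conj (nat 1)) ≡ wins s (G ⊕ int k)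
  wins-prev (+ n) {G} a s = begin
    wins s ((G ⊕ nat (suc n)) ⊕ stack right 1)                ≡⟨ wins-≈ s (⊕-congʳ (stack right 1) (⊕-stack-suc left G n)) ⟩
    wins s (((G ⊕ nat n) ⊕ nat 1) ⊕ stack right 1)            ≡⟨ cong (wins s) (⊕-assoc (G ⊕ nat n) (nat 1) (stack right 1)) ⟩
    wins s ((G ⊕ nat n) ⊕ (nat 1 ⊕ stack right 1))            ≡⟨ ⊕-cancel 1 (closed _ _ a (A-stack left n)) s ⟩
    wins s (G ⊕ nat n)                                        ∎
    where open ≡-Reasoning
  wins-prev -[1+ n ] {G} a s rewrite int-next-neg n = wins-≈ s (≈-sym (⊕-stack-suc right G n))

  -- As `next (reflect k)` is -k, regrouping the four summands leaves `G ⊕ H` beside an integer and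
  -- its conjugate.
  wins-shift : ∀ k {G H} → A G → A H → ∀ s →
    wins s ((G ⊕ int k) ⊕ (H ⊕ int (next (reflect k)))) ≡ wins s (G ⊕ H)
  wins-shift (+ n) {G} {H} a b s rewrite int-next-neg n =
    trans (wins-≈ s (interchange G (nat n) H (conj (nat n)))) (⊕-cancel n (closed _ _ a b) s)
  wins-shift -[1+ n ] {G} {H} a b s =
    trans (wins-≈ s (interchange G (conj (nat (suc n))) H (nat (suc n)))) (⊕-cancel′ (suc n) (closed _ _ a b) s)

  -- The same regrouping with the shift k + 1, since `reflect k` is -(k + 1).
  wins-shift′ : ∀ k {G H} → A G → A H → ∀ s →
    wins s ((G ⊕ int (next k)) ⊕ (H ⊕ int (reflect k))) ≡ wins s (G ⊕ H)
  wins-shift′ (+ n) {G} {H} a b s =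
    trans (wins-≈ s (interchange G (nat (suc n)) H (conj (nat (suc n))))) (⊕-cancel (suc n) (closed _ _ a b) s)
  wins-shift′ -[1+ n ] {G} {H} a b s rewrite int-next-neg n =
    trans (wins-≈ s (interchange G (conj (nat n)) H (nat n))) (⊕-cancel′ n (closed _ _ a b) s)

  -- Left spends the added unit and leaves Right to move on G + k.
  lf-next : ∀ k {G} → A G → rf (G ⊕ int k) ≡ false → lf (G ⊕ int (next k)) ≡ true
  lf-next k {G} a l = trans (sym (wins-next k a left)) (wins-⊕stack1 left (G ⊕ int k) l)

  -- The key lemma, by induction on the total size.

  Key : Game → Game → Set
  Key G H = ∀ k → lf (G ⊕ int k) ≡ true → rf (H ⊕ int (reflect k)) ≡ false → lf (G ⊕ H) ≡ true

  -- The induction hypothesis covers all pairs and all integers at once, because a reply in `H`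
  -- exchanges the summands and turns k into -k - 1.
  KeyBelow : ℕ → Set
  KeyBelow n = ∀ {G H} → P G → P H → size G + size H < n → Key G H

  -- The winning first move on G + k is made in G (or is not needed).
  Local : Game → ℤ → Set
  Local G k = end left (G ⊕ int k) ≡ true ⊎ (∃[ g ] g ∈ leftOpts G × rf (g ⊕ int k) ≡ false)

  local⇒lf : ∀ G k → Local G k → lf (G ⊕ int k) ≡ true
  local⇒lf G k (inj₁ e)           = end⇒wins left (G ⊕ int k) e
  local⇒lf G k (inj₂ (g , m , l)) = move⇒wins left (G ⊕ int k) (∈-⊕ˡ left G (int k) m) l

  -- Both G + k and H − k are 𝓝 with tipping points one step away.
  end-case : ∀ {G H} → P G → P H → ∀ k → end left (G ⊕ int k) ≡ true →
    rf (H ⊕ int (reflect k)) ≡ false → rf (H ⊕ int (next (reflect k))) ≡ true →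
    lf (G ⊕ int (next k)) ≡ false → lf (G ⊕ H) ≡ true
  end-case {G} {H} pG pH k eU rH rV lG = trans (sym (wins-shift k aG aH left)) sum-lf
    where
    aG = proj₁ pG
    aH = proj₁ pH
    U V : Game
    U = G ⊕ int k
    V = H ⊕ int (next (reflect k))
    pU : P U
    pU = P-⊕int k pG
    pV : P V
    pV = P-⊕int (next (reflect k)) pH
    U𝓝 : outcome U ≡ 𝓝
    U𝓝 = outcome-𝓝 U (end⇒wins left U eU) (¬false⇒true λ l → true≢false (lf-next k aG l) lG)
    V𝓝 : outcome V ≡ 𝓝
    V𝓝 = outcome-𝓝 V (lf-next (reflect k) aH rH) rV
    rtpU : IsRtp U 1
    -- The tipping point is exactly 1: `U` + 1 has the outcome of G + k + 1, which is 𝓡, while `U`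
    -- itself is 𝓝.
    rtpU = trans (outcome-cong (wins-next k aG))
                 (outcome-𝓡 (G ⊕ int (next k)) lG (opp-wins left (P-⊕int (next k) pG) lG))
         , λ { zero _ e → 𝓝≢𝓡 (trans (sym U𝓝) (trans (cong outcome (sym (⊕-identityʳ U))) e))
             ; (suc _) (s≤s ()) _ }
      where
      𝓝≢𝓡 : ¬ (𝓝 ≡ 𝓡)
      𝓝≢𝓡 ()
    ltpV : IsLtp V 1
    ltpV = trans (outcome-cong (wins-prev (reflect k) aH))
                 (outcome-𝓛 (H ⊕ int (reflect k)) (opp-wins right (P-⊕int (reflect k) pH) rH) rH)
         , λ { zero _ e → 𝓝≢𝓛 (trans (sym V𝓝) (trans (cong outcome (sym (⊕-identityʳ V))) e))
             ; (suc _) (s≤s ()) _ }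
      where
      𝓝≢𝓛 : ¬ (𝓝 ≡ 𝓛)
      𝓝≢𝓛 ()
    sum-lf : lf (U ⊕ V) ≡ true
    -- Property X asks that `V` not be Left end-like; if it is, the whole sum is Left end-like and
    -- Left wins at once.
    sum-lf with dichotomy (end left V)
    ... | inj₁ e = end⇒wins left (U ⊕ V) (trans (end-⊕ left U V) (cong₂ _∧_ eU e))
    ... | inj₂ e = trans (lf-outcome (U ⊕ V)) (cong leftWins
      (proj₁ (propX U V pU pV U𝓝 V𝓝) rtpU ltpV eU (λ t → true≢false t e)))

  -- Whatever Right answers to g + H, the position falls under the key lemma again.
  move-case : ∀ {G H} → P G → P H → KeyBelow (size G + size H) → ∀ k {g} → g ∈ leftOpts G →
    rf (g ⊕ int k) ≡ false → rf (H ⊕ int (reflect k)) ≡ false → lf (G ⊕ H) ≡ true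
  move-case {G} {H} pG pH below k {g} m l rH =
    move⇒wins left (G ⊕ H) (∈-⊕ˡ left G H m) (loses right (g ⊕ H) (not-end k l rH) replies)
    where
    pg = P-opts left pG m
    -- One of k and -k - 1 is nonnegative. Right loses moving first on the corresponding sum, so its
    -- summand `g` or `H` is not Right end-like.
    not-end : ∀ k → rf (g ⊕ int k) ≡ false → rf (H ⊕ int (reflect k)) ≡ false → end right (g ⊕ H) ≡ false
    not-end (+ n)    l _ rewrite end-⊕ right g H | ¬rightEnd-nat g n l = refl
    not-end -[1+ n ] _ l rewrite end-⊕ right g H | ¬rightEnd-nat H n l = ∧-zeroʳ (end right g)
    replies : ∀ {x} → x ∈ rightOpts (g ⊕ H) → lf x ≡ true
    replies o with ∈-⊕⁻ right g H o
    -- Right loses moving first on g + k, so Left wins moving first on g′ + k: the same k serves.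
    ... | inj₁ (g′ , o′ , refl) =
      below (P-opts right pg o′) pH
        (+-monoˡ-< (size H) (<-trans (size-opts right g o′) (size-opts left G m))) k
        (loses⇒opp-wins right (g ⊕ int k) l (∈-⊕ˡ right g (int k) o′)) rH
    -- The summands exchange roles: Left wins moving first on h - k - 1, and Right's loss on g + k
    -- is the other hypothesis, as `reflect` is an involution.
    ... | inj₂ (h , o′ , refl) = trans (wins-≈ left (⊕-comm g h))
      (below (P-opts right pH o′) pg
        (subst (_< size G + size H) (+-comm (size g) (size h))
          (+-mono-< (size-opts left G m) (size-opts right H o′))) (reflect k)
        (loses⇒opp-wins right (H ⊕ int (reflect k)) rH (∈-⊕ˡ right H (int (reflect k)) o′))
        (subst (λ i → rf (g ⊕ int i) ≡ false) (sym (reflect-involutive k)) l))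
      where
      reflect-involutive : ∀ k → reflect (reflect k) ≡ k
      reflect-involutive (+ _)    = refl
      reflect-involutive -[1+ _ ] = refl

  key-local : ∀ {G H} → P G → P H → KeyBelow (size G + size H) → ∀ k → Local G k →
    rf (H ⊕ int (reflect k)) ≡ false → lf (G ⊕ H) ≡ true
  key-local {G} {H} pG pH below k loc rH
    with dichotomy (rf (H ⊕ int (next (reflect k)))) | dichotomy (lf (G ⊕ int (next k))) | loc
  -- Right already loses moving first on H - k, so stability applies to (G + k) + (H - k).
  ... | inj₂ l | _ | _ = trans (sym (wins-shift k (proj₁ pG) (proj₁ pH) left))
    (wins-⊕′ left (P-⊕int k pG) (P-⊕int (next (reflect k)) pH) (local⇒lf G k loc) l)
  -- Left still wins moving first on G + k + 1, so stability applies to (G + k + 1) + (H - k - 1).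
  ... | inj₁ _ | inj₁ w | _ = trans (sym (wins-shift′ k (proj₁ pG) (proj₁ pH) left))
    (wins-⊕′ left (P-⊕int (next k) pG) (P-⊕int (reflect k) pH) w rH)
  ... | inj₁ w | inj₂ l | inj₁ e = end-case pG pH k e rH w l
  ... | inj₁ _ | inj₂ _ | inj₂ (g , m , l) = move-case pG pH below k m l rH

  -- Left can move in the integer only when it is positive, and then only to its predecessor.
  first-move : ∀ G k → lf (G ⊕ int k) ≡ true →
    Local G k ⊎ (∃[ n ] k ≡ + suc n × rf (G ⊕ nat n) ≡ false)
  first-move G k w with wins⇒ left (G ⊕ int k) w
  ... | inj₁ e = inj₁ (inj₁ e)
  ... | inj₂ (x , m , l) with ∈-⊕⁻ left G (int k) m
  ... | inj₁ (g , o , refl) = inj₁ (inj₂ (g , o , l))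
  ... | inj₂ (y , o , refl) with leftOpts-int k o
  ... | n , refl , refl = inj₂ (n , refl , l)

  key-step : ∀ {G H} → P G → P H → KeyBelow (size G + size H) → Key G H
  key-step {G} {H} pG pH below k w l with first-move G k w
  ... | inj₁ loc = key-local pG pH below k loc l
  -- Left's move is in the integer: exchange G and H, since H − k has no integer move for Left.
  ... | inj₂ (n , refl , l′) with first-move H -[1+ n ] (lf-next -[1+ suc n ] (proj₁ pH) l)
  -- Here k = n + 1. The exchanged pair is used at -k = -n - 1, whose reflection is n, and `l′` is
  -- Right's loss on G + n.
  ... | inj₁ loc = trans (wins-≈ left (⊕-comm G H))
    (key-local pH pG (subst KeyBelow (+-comm (size G) (size H)) below) -[1+ n ] loc l′)
  ... | inj₂ (_ , () , _)

  key-acc : ∀ {n} → Acc _<_ n → KeyBelow n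
  key-acc (acc rs) pG pH lt = key-step pG pH (key-acc (rs lt))

  key : ∀ {G H} → P G → P H → Key G H
  key pG pH = key-acc (<-wellFounded _) pG pH ≤-refl

  -- At the last k for which Left wins first on G + k, G + (k + 1) is 𝓡 while the key lemma
  -- forbids H − (k + 1) from being 𝓛.
  ⊕-loses⇒rf : ∀ {G H} → P G → P H → lf G ≡ true → lf (G ⊕ H) ≡ false → rf (G ⊕ H) ≡ true
  ⊕-loses⇒rf {G} {H} pG pH w l
    -- The search runs from 0, where `w` gives the win, to `suc (size G)`, where Left is sure to
    -- lose moving first.
    with last-true (λ n → lf (G ⊕ nat n)) (suc (size G)) (trans (cong lf (⊕-identityʳ G)) w)
           (left-loses-⊕nat (smaller-wellFounded G) (size G) ≤-refl)
  ... | n , w′ , l′ = trans (sym (wins-shift′ (+ n) (proj₁ pG) (proj₁ pH) right))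
    (wins-⊕ right (P-⊕int (+ suc n) pG) (P-⊕int -[1+ n ] pH) l′
      (¬false⇒true λ e → true≢false (key pG pH (+ n) w′ e) l))

  -- If Left loses first on the sum but wins first on `G`, the search for the last k can start. If
  -- she loses first on `G`, then `G` is 𝓡: either Right wins first on `H` and stability applies, or
  -- `H` is 𝓛 and the search starts from `H`.
  ⊕-¬𝓟 : ∀ {G H} → P G → P H → ¬ (outcome (G ⊕ H) ≡ 𝓟)
  ⊕-¬𝓟 {G} {H} pG pH with dichotomy (lf (G ⊕ H)) | dichotomy (lf G) | dichotomy (rf H)
  ... | inj₁ w | _      | _      = wins⇒¬𝓟 left (G ⊕ H) w
  ... | inj₂ l | inj₁ w | _      = wins⇒¬𝓟 right (G ⊕ H) (⊕-loses⇒rf pG pH w l)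
  ... | inj₂ l | inj₂ e | inj₁ w = wins⇒¬𝓟 right (G ⊕ H) (wins-⊕ right pG pH e w)
  ... | inj₂ l | inj₂ _ | inj₂ e = wins⇒¬𝓟 right (G ⊕ H) (trans (wins-≈ right (⊕-comm G H))
    (⊕-loses⇒rf pH pG (opp-wins right pH e) (trans (wins-≈ left (⊕-comm H G)) l)))

  -- Closure under sums and the monoid structure.

  P-⊕ : ∀ G H → P G → P H → P (G ⊕ H)
  P-⊕ G H pG pH = closed G H (proj₁ pG) (proj₁ pH) , free
    where
    free : StrictlyPFree (G ⊕ H)
    free K p with subpos-⊕ G H p
    ... | G′ , H′ , q , q′ , refl = ⊕-¬𝓟 (P-subpos pG q) (P-subpos pH q′)

  P-zero : P zeroG
  P-zero = A-stack left 0 , λ { _ here () }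

  P-isMonoid : IsMonoidOfGames P
  P-isMonoid = (zeroG , P-zero) , P-⊕ , zeroG , P-zero , identity
    where
    identity : ∀ G → P G → (G ⊕ zeroG) ≡[ P ] G
    identity G _ rewrite ⊕-identityʳ G = (λ _ _ → ≥o-refl _) , (λ _ _ → ≥o-refl _)

theorem3p19 : (A : GameSet) → IsMonoidOfGames A → OutcomeStable A →
    Hereditary A → IntegerInvertible A → PropertyX A →
    IsMonoidOfGames (PFreePart A)
theorem3p19 A (_ , closed , _) stable hereditary invertible propX =
  P-isMonoid A closed stable hereditary invertible propX
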